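{- Let $p=q=1/2$ and let $X_{n,s}$ be the number of turns required to end the single-player pile game with boundary with set of choices $R=\{1,-1\}$ and target $n$, starting with $s$ chips, $0\le s\le n$. Then $$E[X_{n,s}]=n(n+1)-s(s+1).$$
   Context: Single-player pile game with boundary, $R=\{1,-1\}$: the player starts with $s$ chips, $0\le s\le n$. In each turn, independently, with probability $p$ one chip is added, and with probability $q=1-p$ one chip is removed, except that if the player has $0$ chips he stays at $0$ instead. The game ends when the player first has $n$ chips (at turn $0$ if $s=n$). -}

module Defs where

open import Data.List using (List; []; _∷_; map; foldr; filter; cartesianProductWith)
open import Data.Nat as ℕ using (ℕ; zero; suc; pred)
open import Data.Integer as ℤ using (+_)
open import Data.Product using (_×_; ∃-syntax)
open import Data.Rational using (ℚ; 0ℚ; 1ℚ; _+_; _-_; _*_; _<_; _/_; ∣_∣)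
open import Data.Vec as Vec using (Vec; []; _∷_)
open import Level using (0ℓ)
open import Relation.Binary.PropositionalEquality using (_≡_; _≢_; refl)
open import Relation.Nullary using (yes; no)
open import Relation.Unary using (Pred; Decidable)

data Move : Set where
  add remove : Move

-- `pred zero` is `zero`, which is the boundary rule: at 0 chips the player
-- stays at 0.
step : Move → ℕ → ℕ
step add    = suc
step remove = pred

-- `Play n s w`: starting with s chips, the game with target n lasts exactly
-- as long as w, its successive moves being those of w.
data Play (n : ℕ) : ℕ → ∀ {k} → Vec Move k → Set where
  end  : Play n n []
  turn : ∀ {s m k} {w : Vec Move k} →
         s ≢ n → Play n (step m s) w → Play n s (m ∷ w)

play? : ∀ n s {k} → Decidable (Play n s {k})
play? n s [] with s ℕ.≟ n
... | yes refl = yes end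
... | no  s≢n  = no λ { end → s≢n refl }
play? n s (m ∷ w) with s ℕ.≟ n | play? n (step m s) w
... | yes s≡n | _      = no λ { (turn s≢n _) → s≢n s≡n }
... | no  s≢n | yes pl = yes (turn s≢n pl)
... | no  _   | no ¬pl = no λ { (turn _ pl) → ¬pl pl }

moveProb : ℚ → Move → ℚ
moveProb p add    = p
moveProb p remove = 1ℚ - p

sequences : ∀ k → List (Vec Move k)
sequences zero    = [] ∷ []
sequences (suc k) = cartesianProductWith _∷_ (add ∷ remove ∷ []) (sequences k)

-- Independence of the turns: a sequence has the product of the probabilities
-- of its moves.
seqProb : ℚ → ∀ {k} → Vec Move k → ℚ
seqProb p w = Vec.foldr′ _*_ 1ℚ (Vec.map (moveProb p) w)

-- The probability of an event determined by the first k moves.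
Prob : ℚ → ∀ {k} {A : Pred (Vec Move k) 0ℓ} → Decidable A → ℚ
Prob p {k} A? = foldr _+_ 0ℚ (map (seqProb p) (filter A? (sequences k)))

-- `law-X p n s k` is P(X_{n,s} = k), X_{n,s} being the number of turns
-- required to end the game; that event depends on the first k moves only.
law-X : (p : ℚ) (n s : ℕ) → ℕ → ℚ
law-X p n s k = Prob p (play? n s {k})

fromℕ : ℕ → ℚ
fromℕ k = + k / 1

∑< : ℕ → (ℕ → ℚ) → ℚ
∑< zero    f = 0ℚ
∑< (suc m) f = ∑< m f + f m

_⟶_ : (ℕ → ℚ) → ℚ → Set
u ⟶ L = ∀ ε → 0ℚ < ε → ∃[ N ] ∀ m → N ℕ.≤ m → ∣ u m - L ∣ < ε

-- A random variable X with values in ℕ ∪ {∞} and P(X = k) = μ k has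
-- expectation e < ∞.  The first component says that X is almost surely
-- finite; without it the expectation would be infinite whatever the value of
-- the series ∑ k P(X = k).
HasExpectation : (μ : ℕ → ℚ) → ℚ → Set
HasExpectation μ e =
  ((λ m → ∑< m μ) ⟶ 1ℚ) ×
  ((λ m → ∑< m (λ k → fromℕ k * μ k)) ⟶ e)

{-# OPTIONS --safe #-}

-- Let h s = n(n+1) - s(s+1), T s m = P(X_{n,s} ≥ m) and
-- D s m = h s - ∑_{k<m} k P(X_{n,s} = k), and let avg be the expectation after
-- one turn.  For s < n, conditioning on the first turn gives
-- T s (m+1) = avg T and, since h = 1 + avg h, D s (m+1) = avg D + avg T; at
-- s = n both vanish for m ≥ 1.  The function g = h + 1 is bounded and averaging
-- lowers it by 1, so once K ≥ 2g the functions g (1 - 1/K)^m and K g (1 - 1/K)^m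
-- are supersolutions of these two recursions.  They dominate T and D, and by
-- Bernoulli's inequality they are O(1/m).
module Submission where

open import Data.Nat as ℕ using (ℕ; zero; suc; pred; _≤_; _+_; _*_)
import Data.Nat.Properties as ℕ
import Data.Nat.Tactic.RingSolver as ℕ
open import Data.Integer as ℤ using (+_; +[1+_]; -[1+_])
import Data.Integer.Properties as ℤ
open import Data.List using (List; []; _∷_; _++_; map; foldr; filter)
open import Data.List.Properties using (filter-accept; filter-reject; ++-identityʳ)
open import Data.Product using (_,_; ∃-syntax)
open import Data.Rational as ℚ using (ℚ; mkℚ; 0ℚ; 1ℚ; ½; _-_; ∣_∣)
import Data.Rational.Properties as ℚ
open import Data.Rational.Unnormalised as ℚᵘ using (mkℚᵘ; *≡*)
import Data.Rational.Unnormalised.Properties as ℚᵘ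
open import Data.Vec using (Vec; _∷_)
open import Level using (0ℓ)
open import Function using (_∘_)
open import Relation.Binary.PropositionalEquality
open import Relation.Nullary using (¬_; Dec; yes; no; contradiction)
open import Relation.Nullary.Decidable using (dec⇒maybe)
open import Relation.Unary using (Pred; Decidable)
open import Tactic.RingSolver using (solve-∀)
import Tactic.RingSolver.Core.AlmostCommutativeRing as ACR
open import Defs

-- Arithmetic and order of the rationals.

ℚ-ring : ACR.AlmostCommutativeRing 0ℓ 0ℓ
ℚ-ring = ACR.fromCommutativeRing ℚ.+-*-commutativeRing (dec⇒maybe ∘ (0ℚ ℚ.≟_))

0≤+ : ∀ {p q} → 0ℚ ℚ.≤ p → 0ℚ ℚ.≤ q → 0ℚ ℚ.≤ p ℚ.+ q
0≤+ = ℚ.+-mono-≤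

0≤* : ∀ {p q} → 0ℚ ℚ.≤ p → 0ℚ ℚ.≤ q → 0ℚ ℚ.≤ p ℚ.* q
0≤* {p} {q} 0≤p 0≤q = ℚ.nonNegative⁻¹ (p ℚ.* q)
  {{ℚ.nonNeg*nonNeg⇒nonNeg p {{ℚ.nonNegative 0≤p}} q {{ℚ.nonNegative 0≤q}}}}

p≤q⇒0≤q-p : ∀ {p q} → p ℚ.≤ q → 0ℚ ℚ.≤ q - p
p≤q⇒0≤q-p {p} {q} p≤q = subst (ℚ._≤ q - p) (ℚ.+-inverseʳ p) (ℚ.+-monoˡ-≤ (ℚ.- p) p≤q)

-- Naming the difference `d` splits an inequality into a sign condition and an equation; the
-- equation is then usually left to the ring solver.
≤-by-difference : ∀ {p q d} → 0ℚ ℚ.≤ d → q ≡ p ℚ.+ d → p ℚ.≤ q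
≤-by-difference {p} {q} {d} 0≤d q≡p+d =
  subst₂ ℚ._≤_ (ℚ.+-identityʳ p) (sym q≡p+d) (ℚ.+-monoʳ-≤ p 0≤d)

*-monoˡ-≤ : ∀ {r p q} → 0ℚ ℚ.≤ r → p ℚ.≤ q → r ℚ.* p ℚ.≤ r ℚ.* q
*-monoˡ-≤ {r} 0≤r = ℚ.*-monoˡ-≤-nonNeg r {{ℚ.nonNegative 0≤r}}

*-monoʳ-≤ : ∀ {r p q} → 0ℚ ℚ.≤ r → p ℚ.≤ q → p ℚ.* r ℚ.≤ q ℚ.* r
*-monoʳ-≤ {r} 0≤r = ℚ.*-monoʳ-≤-nonNeg r {{ℚ.nonNegative 0≤r}}

toℚᵘ-fromℕ : ∀ a → ℚ.toℚᵘ (fromℕ a) ℚᵘ.≃ mkℚᵘ (+ a) 0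
toℚᵘ-fromℕ a = ℚ.toℚᵘ-fromℚᵘ (mkℚᵘ (+ a) 0)

fromℕ-+ : ∀ a b → fromℕ (a + b) ≡ fromℕ a ℚ.+ fromℕ b
fromℕ-+ a b = ℚ.toℚᵘ-injective (begin
  ℚ.toℚᵘ (fromℕ (a + b))                     ≈⟨ toℚᵘ-fromℕ (a + b) ⟩
  mkℚᵘ (+ (a + b)) 0                         ≈⟨ *≡* (cong (ℤ._* + 1) (sym (cong₂ ℤ._+_ (ℤ.*-identityʳ (+ a)) (ℤ.*-identityʳ (+ b))))) ⟩
  mkℚᵘ (+ a) 0 ℚᵘ.+ mkℚᵘ (+ b) 0             ≈⟨ ℚᵘ.+-cong (toℚᵘ-fromℕ a) (toℚᵘ-fromℕ b) ⟨
  ℚ.toℚᵘ (fromℕ a) ℚᵘ.+ ℚ.toℚᵘ (fromℕ b)     ≈⟨ ℚ.toℚᵘ-homo-+ (fromℕ a) (fromℕ b) ⟨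
  ℚ.toℚᵘ (fromℕ a ℚ.+ fromℕ b)               ∎)
  where open ℚᵘ.≃-Reasoning

fromℕ-* : ∀ a b → fromℕ (a * b) ≡ fromℕ a ℚ.* fromℕ b
fromℕ-* a b = ℚ.toℚᵘ-injective (begin
  ℚ.toℚᵘ (fromℕ (a * b))                     ≈⟨ toℚᵘ-fromℕ (a * b) ⟩
  mkℚᵘ (+ (a * b)) 0                         ≈⟨ *≡* (cong (ℤ._* + 1) (ℤ.pos-* a b)) ⟩
  mkℚᵘ (+ a) 0 ℚᵘ.* mkℚᵘ (+ b) 0             ≈⟨ ℚᵘ.*-cong (toℚᵘ-fromℕ a) (toℚᵘ-fromℕ b) ⟨
  ℚ.toℚᵘ (fromℕ a) ℚᵘ.* ℚ.toℚᵘ (fromℕ b)     ≈⟨ ℚ.toℚᵘ-homo-* (fromℕ a) (fromℕ b) ⟨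
  ℚ.toℚᵘ (fromℕ a ℚ.* fromℕ b)               ∎)
  where open ℚᵘ.≃-Reasoning

0≤fromℕ : ∀ a → 0ℚ ℚ.≤ fromℕ a
0≤fromℕ a = ℚ.nonNegative⁻¹ (fromℕ a) {{ℚ.normalize-nonNeg a 1}}

fromℕ-mono-≤ : ∀ {a b} → a ≤ b → fromℕ a ℚ.≤ fromℕ b
fromℕ-mono-≤ {a} {b} a≤b = ≤-by-difference (0≤fromℕ (b ℕ.∸ a))
  (trans (cong fromℕ (sym (ℕ.m+[n∸m]≡n a≤b))) (fromℕ-+ a (b ℕ.∸ a)))

fromℕ-suc : ∀ a → fromℕ (suc a) ≡ 1ℚ ℚ.+ fromℕ a
fromℕ-suc = fromℕ-+ 1

-- The Archimedean property and a convergence criterion.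

*-denominator : ∀ p → p ℚ.* fromℕ (ℚ.↧ₙ p) ≡ ℚ.↥ p ℚ./ 1
*-denominator p@(mkℚ i d _) = ℚ.toℚᵘ-injective (begin
  ℚ.toℚᵘ (p ℚ.* fromℕ (suc d))               ≈⟨ ℚ.toℚᵘ-homo-* p (fromℕ (suc d)) ⟩
  ℚ.toℚᵘ p ℚᵘ.* ℚ.toℚᵘ (fromℕ (suc d))       ≈⟨ ℚᵘ.*-congˡ {ℚ.toℚᵘ p} (toℚᵘ-fromℕ (suc d)) ⟩
  mkℚᵘ i d ℚᵘ.* mkℚᵘ (+ suc d) 0             ≈⟨ *≡* (trans (ℤ.*-identityʳ _) (cong (λ e → i ℤ.* + e) (sym (ℕ.*-identityʳ (suc d))))) ⟩
  mkℚᵘ i 0                                   ≈⟨ ℚ.toℚᵘ-fromℚᵘ (mkℚᵘ i 0) ⟨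
  ℚ.toℚᵘ (i ℚ./ 1)                           ∎)
  where open ℚᵘ.≃-Reasoning

archimedean : ∀ C ε → 0ℚ ℚ.< ε → ∃[ N ] ∀ m → N ≤ m → fromℕ C ℚ.< ε ℚ.* fromℕ m
archimedean C ε@(mkℚ (+ zero) _ _)   0<ε = contradiction (ℚ.positive 0<ε) λ ()
archimedean C ε@(mkℚ -[1+ _ ] _ _)   0<ε = contradiction (ℚ.positive 0<ε) λ ()
-- Here `ε` is `(a + 1) / (d + 1)`. The factor `suc d` clears the denominator, which leaves
-- `(a + 1)(C + 1)`, at least `C + 1`; the successor of `C` makes the bound strict.
archimedean C ε@(mkℚ +[1+ a ] d _)   0<ε = suc d * suc C , λ m N≤m → begin-strict
  fromℕ C                                ≡⟨ ℚ.+-identityˡ (fromℕ C) ⟨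
  0ℚ ℚ.+ fromℕ C                         <⟨ ℚ.+-monoˡ-< (fromℕ C) (ℚ.positive⁻¹ 1ℚ) ⟩
  1ℚ ℚ.+ fromℕ C                         ≡⟨ fromℕ-suc C ⟨
  fromℕ (suc C)                          ≤⟨ fromℕ-mono-≤ (ℕ.m≤n*m (suc C) (suc a)) ⟩
  fromℕ (suc a * suc C)                  ≡⟨ fromℕ-* (suc a) (suc C) ⟩
  fromℕ (suc a) ℚ.* fromℕ (suc C)        ≡⟨ cong (ℚ._* fromℕ (suc C)) (*-denominator ε) ⟨
  ε ℚ.* fromℕ (suc d) ℚ.* fromℕ (suc C)  ≡⟨ ℚ.*-assoc ε (fromℕ (suc d)) (fromℕ (suc C)) ⟩
  ε ℚ.* (fromℕ (suc d) ℚ.* fromℕ (suc C)) ≡⟨ cong (ε ℚ.*_) (fromℕ-* (suc d) (suc C)) ⟨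
  ε ℚ.* fromℕ (suc d * suc C)            ≤⟨ *-monoˡ-≤ (ℚ.<⇒≤ 0<ε) (fromℕ-mono-≤ N≤m) ⟩
  ε ℚ.* fromℕ m                          ∎
  where open ℚ.≤-Reasoning

-- The error is at most `C / m`. The rate is stated multiplied by `m`, so that nothing is divided
-- and `m = 0` is no exception.
convergence-from-below : ∀ C u L → (∀ m → 0ℚ ℚ.≤ L - u m) →
  (∀ m → (L - u m) ℚ.* fromℕ m ℚ.≤ fromℕ C) → u ⟶ L
convergence-from-below C u L below rate ε 0<ε with archimedean C ε 0<ε
... | N , C<εm = N , λ m N≤m →
  subst (ℚ._< ε) (sym (∣u-L∣≡L-u m))
    (ℚ.*-cancelʳ-<-nonNeg (fromℕ m) {{ℚ.normalize-nonNeg m 1}}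
      (ℚ.≤-<-trans (rate m) (C<εm m N≤m)))
  where
  -‿swap : ∀ p q → p - q ≡ ℚ.- (q - p)
  -‿swap = solve-∀ ℚ-ring

  ∣u-L∣≡L-u : ∀ m → ∣ u m - L ∣ ≡ L - u m
  ∣u-L∣≡L-u m = trans (cong ∣_∣ (-‿swap (u m) L))
    (trans (ℚ.∣-p∣≡∣p∣ (L - u m)) (ℚ.0≤p⇒∣p∣≡p (below m)))

-- One-turn averages and finite sums.

avg : (ℕ → ℚ) → ℕ → ℚ
avg f s = ½ ℚ.* f (suc s) ℚ.+ ½ ℚ.* f (pred s)

avg-nonNeg : ∀ {f s} → 0ℚ ℚ.≤ f (suc s) → 0ℚ ℚ.≤ f (pred s) → 0ℚ ℚ.≤ avg f s
avg-nonNeg 0≤f₊ 0≤f₋ = 0≤+ (0≤* (ℚ.nonNegative⁻¹ ½) 0≤f₊) (0≤* (ℚ.nonNegative⁻¹ ½) 0≤f₋)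

avg-mono-≤ : ∀ {f g s} → f (suc s) ℚ.≤ g (suc s) → f (pred s) ℚ.≤ g (pred s) → avg f s ℚ.≤ avg g s
avg-mono-≤ f≤g₊ f≤g₋ = ℚ.+-mono-≤ (*-monoˡ-≤ (ℚ.nonNegative⁻¹ ½) f≤g₊) (*-monoˡ-≤ (ℚ.nonNegative⁻¹ ½) f≤g₋)

∑<-cong : ∀ {f g} m → (∀ k → f k ≡ g k) → ∑< m f ≡ ∑< m g
∑<-cong zero    f≗g = refl
∑<-cong (suc m) f≗g = cong₂ ℚ._+_ (∑<-cong m f≗g) (f≗g m)

∑<-zero : ∀ m → ∑< m (λ _ → 0ℚ) ≡ 0ℚ
∑<-zero zero    = refl
∑<-zero (suc m) = trans (ℚ.+-identityʳ _) (∑<-zero m)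

∑<-suc : ∀ f m → ∑< (suc m) f ≡ f 0 ℚ.+ ∑< m (f ∘ suc)
∑<-suc f zero    = ℚ.+-comm 0ℚ (f 0)
∑<-suc f (suc m) = trans (cong (ℚ._+ f (suc m)) (∑<-suc f m)) (ℚ.+-assoc (f 0) _ (f (suc m)))

∑<-+ : ∀ f g m → ∑< m (λ k → f k ℚ.+ g k) ≡ ∑< m f ℚ.+ ∑< m g
∑<-+ f g zero    = refl
∑<-+ f g (suc m) = trans (cong (ℚ._+ (f m ℚ.+ g m)) (∑<-+ f g m))
  (interchange (∑< m f) (∑< m g) (f m) (g m))
  where
  interchange : ∀ a b c d → a ℚ.+ b ℚ.+ (c ℚ.+ d) ≡ a ℚ.+ c ℚ.+ (b ℚ.+ d)
  interchange = solve-∀ ℚ-ring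

∑<-avg : ∀ (f : ℕ → ℕ → ℚ) s m → ∑< m (λ k → avg (λ t → f t k) s) ≡ avg (λ t → ∑< m (f t)) s
∑<-avg f s zero    = refl
∑<-avg f s (suc m) = trans (cong (ℚ._+ avg (λ t → f t m) s) (∑<-avg f s m))
  (distrib (∑< m (f (suc s))) (∑< m (f (pred s))) (f (suc s) m) (f (pred s) m))
  where
  distrib : ∀ a b c d → ½ ℚ.* a ℚ.+ ½ ℚ.* b ℚ.+ (½ ℚ.* c ℚ.+ ½ ℚ.* d) ≡ ½ ℚ.* (a ℚ.+ c) ℚ.+ ½ ℚ.* (b ℚ.+ d)
  distrib = solve-∀ ℚ-ring

-- Conditioning the law on the first turn.

-- This is `Prob` with an arbitrary list in place of `sequences k`, which makes induction on the
-- list possible. At `sequences k` the two agree by definition.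
mass : ℚ → ∀ {k} {A : Pred (Vec Move k) 0ℓ} → Decidable A → List (Vec Move k) → ℚ
mass p A? ws = foldr ℚ._+_ 0ℚ (map (seqProb p) (filter A? ws))

mass-accept : ∀ p {k} {A : Pred (Vec Move k) 0ℓ} (A? : Decidable A) w ws → A w →
  mass p A? (w ∷ ws) ≡ seqProb p w ℚ.+ mass p A? ws
mass-accept p A? w ws a = cong (foldr ℚ._+_ 0ℚ ∘ map (seqProb p)) (filter-accept A? {xs = ws} a)

mass-reject : ∀ p {k} {A : Pred (Vec Move k) 0ℓ} (A? : Decidable A) w ws → ¬ A w →
  mass p A? (w ∷ ws) ≡ mass p A? ws
mass-reject p A? w ws ¬a = cong (foldr ℚ._+_ 0ℚ ∘ map (seqProb p)) (filter-reject A? {xs = ws} ¬a)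

mass-++ : ∀ p {k} {A : Pred (Vec Move k) 0ℓ} (A? : Decidable A) ws ws′ →
  mass p A? (ws ++ ws′) ≡ mass p A? ws ℚ.+ mass p A? ws′
mass-++ p A? []       ws′ = sym (ℚ.+-identityˡ _)
mass-++ p A? (w ∷ ws) ws′ with A? w
... | yes _ = trans (cong (seqProb p w ℚ.+_) (mass-++ p A? ws ws′)) (sym (ℚ.+-assoc (seqProb p w) _ _))
... | no  _ = mass-++ p A? ws ws′

mass-none : ∀ p {k} {A : Pred (Vec Move k) 0ℓ} (A? : Decidable A) ws →
  (∀ w → ¬ A w) → mass p A? ws ≡ 0ℚ
mass-none p A? []       ¬A = refl
mass-none p A? (w ∷ ws) ¬A = trans (mass-reject p A? w ws (¬A w)) (mass-none p A? ws ¬A)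

-- Away from the target, `mv ∷ w` is a play from `s` exactly when `w` is a play from `step mv s`.
-- Both filters therefore keep the same words, and each kept word on the left carries one more
-- factor `moveProb p mv`.
mass-turn : ∀ p n s → s ≢ n → ∀ mv {k} (ws : List (Vec Move k)) →
  mass p (play? n s) (map (mv ∷_) ws) ≡ moveProb p mv ℚ.* mass p (play? n (step mv s)) ws
mass-turn p n s s≢n mv []       = sym (ℚ.*-zeroʳ (moveProb p mv))
mass-turn p n s s≢n mv (w ∷ ws) = by-cases (play? n (step mv s) w)
  where
  open ≡-Reasoning
  q      = moveProb p mv
  before = play? n s
  after  = play? n (step mv s)

  by-cases : Dec (Play n (step mv s) w) →
    mass p before (map (mv ∷_) (w ∷ ws)) ≡ q ℚ.* mass p after (w ∷ ws)
  by-cases (yes pl) = begin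
    mass p before (map (mv ∷_) (w ∷ ws))                       ≡⟨ mass-accept p before (mv ∷ w) (map (mv ∷_) ws) (turn s≢n pl) ⟩
    q ℚ.* seqProb p w ℚ.+ mass p before (map (mv ∷_) ws)       ≡⟨ cong (q ℚ.* seqProb p w ℚ.+_) (mass-turn p n s s≢n mv ws) ⟩
    q ℚ.* seqProb p w ℚ.+ q ℚ.* mass p after ws                ≡⟨ ℚ.*-distribˡ-+ q (seqProb p w) (mass p after ws) ⟨
    q ℚ.* (seqProb p w ℚ.+ mass p after ws)                    ≡⟨ cong (q ℚ.*_) (mass-accept p after w ws pl) ⟨
    q ℚ.* mass p after (w ∷ ws)                                ∎
  by-cases (no ¬pl) = begin
    mass p before (map (mv ∷_) (w ∷ ws))                       ≡⟨ mass-reject p before (mv ∷ w) (map (mv ∷_) ws) (λ { (turn _ pl) → ¬pl pl }) ⟩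
    mass p before (map (mv ∷_) ws)                             ≡⟨ mass-turn p n s s≢n mv ws ⟩
    q ℚ.* mass p after ws                                      ≡⟨ cong (q ℚ.*_) (mass-reject p after w ws ¬pl) ⟨
    q ℚ.* mass p after (w ∷ ws)                                ∎

law-turn : ∀ p {n s} → s ≢ n → ∀ k →
  law-X p n s (suc k) ≡ p ℚ.* law-X p n (suc s) k ℚ.+ (1ℚ - p) ℚ.* law-X p n (pred s) k
law-turn p {n} {s} s≢n k = begin
  -- `sequences (suc k)` unfolds to this: a block for each first move, with a trailing `[]` from the
  -- product of lists.
  mass p (play? n s) (adds ++ (removes ++ []))
    ≡⟨ cong (λ ws → mass p (play? n s) (adds ++ ws)) (++-identityʳ removes) ⟩
  mass p (play? n s) (adds ++ removes)
    ≡⟨ mass-++ p (play? n s) adds removes ⟩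
  mass p (play? n s) adds ℚ.+ mass p (play? n s) removes
    ≡⟨ cong₂ ℚ._+_ (mass-turn p n s s≢n add (sequences k)) (mass-turn p n s s≢n remove (sequences k)) ⟩
  p ℚ.* law-X p n (suc s) k ℚ.+ (1ℚ - p) ℚ.* law-X p n (pred s) k ∎
  where
  open ≡-Reasoning
  adds    = map (add ∷_) (sequences k)
  removes = map (remove ∷_) (sequences k)

law-end : ∀ p n k → law-X p n n (suc k) ≡ 0ℚ
law-end p n k = mass-none p (play? n n) (sequences (suc k)) λ { (_ ∷ _) (turn n≢n _) → n≢n refl }

law-end-0 : ∀ p n → law-X p n n 0 ≡ 1ℚ
law-end-0 p n = mass-accept p (play? n n) _ [] end

law-turn-0 : ∀ p {n s} → s ≢ n → law-X p n s 0 ≡ 0ℚ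
law-turn-0 p {n} {s} s≢n = mass-none p (play? n s) (sequences 0) λ { _ end → s≢n refl }

-- Recursions for the tail and for the missing part of the expectation.

module Game (n : ℕ) where

  μ : ℕ → ℕ → ℚ
  μ = law-X ½ n

  -- The added 1 makes `g` at least 1 for `s ≤ n`, so that it dominates `T s 0`, which is 1, even at
  -- `s = n`, where `h` vanishes.
  h g : ℕ → ℚ
  h s = fromℕ (n * (n + 1)) - fromℕ (s * (s + 1))
  g s = h s ℚ.+ 1ℚ

  S W T D : ℕ → ℕ → ℚ
  S s m = ∑< m (μ s)
  W s m = ∑< m (λ k → fromℕ k ℚ.* μ s k)
  T s m = 1ℚ - S s m
  D s m = h s - W s m

  -- The polynomial `s(s+1)` takes the same value at 0 and at -1. Staying at 0 thus counts like a
  -- step to -1, and the second difference is 2 at the boundary as well.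
  pronic-avg : ∀ s → suc s * (suc s + 1) + pred s * (pred s + 1) ≡ s * (s + 1) + s * (s + 1) + 2
  pronic-avg zero    = refl
  pronic-avg (suc s) = identity s
    where
    identity : ∀ s → (2 + s) * (2 + s + 1) + s * (s + 1) ≡ (1 + s) * (1 + s + 1) + (1 + s) * (1 + s + 1) + 2
    identity = ℕ.solve-∀

  h-avg : ∀ s → h s ≡ 1ℚ ℚ.+ avg h s
  h-avg s = begin
    e - a                               ≡⟨ expand e a ⟩
    1ℚ ℚ.+ (e - ½ ℚ.* (a ℚ.+ a ℚ.+ fromℕ 2))
      ≡⟨ cong (λ x → 1ℚ ℚ.+ (e - ½ ℚ.* x)) pronic-avgℚ ⟨
    1ℚ ℚ.+ (e - ½ ℚ.* (a₊ ℚ.+ a₋))       ≡⟨ split e a₊ a₋ ⟩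
    1ℚ ℚ.+ avg h s                      ∎
    where
    open ≡-Reasoning
    e  = fromℕ (n * (n + 1))
    a  = fromℕ (s * (s + 1))
    a₊ = fromℕ (suc s * (suc s + 1))
    a₋ = fromℕ (pred s * (pred s + 1))

    pronic-avgℚ : a₊ ℚ.+ a₋ ≡ a ℚ.+ a ℚ.+ fromℕ 2
    pronic-avgℚ = trans (sym (fromℕ-+ (suc s * (suc s + 1)) (pred s * (pred s + 1))))
      (trans (cong fromℕ (pronic-avg s))
      (trans (fromℕ-+ (s * (s + 1) + s * (s + 1)) 2)
      (cong (ℚ._+ fromℕ 2) (fromℕ-+ (s * (s + 1)) (s * (s + 1))))))

    -- `1ℚ ℚ.+ 1ℚ` equals `fromℕ 2` by computation.
    expand : ∀ e a → e - a ≡ 1ℚ ℚ.+ (e - ½ ℚ.* (a ℚ.+ a ℚ.+ (1ℚ ℚ.+ 1ℚ)))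
    expand = solve-∀ ℚ-ring

    split : ∀ e b c → 1ℚ ℚ.+ (e - ½ ℚ.* (b ℚ.+ c)) ≡ 1ℚ ℚ.+ (½ ℚ.* (e - b) ℚ.+ ½ ℚ.* (e - c))
    split = solve-∀ ℚ-ring

  S-turn : ∀ {s} → s ≢ n → ∀ m → S s (suc m) ≡ avg (λ t → S t m) s
  S-turn {s} s≢n m = begin
    ∑< (suc m) (μ s)                          ≡⟨ ∑<-suc (μ s) m ⟩
    -- The weight `1ℚ - ½` in `law-turn ½` computes to `½`, so its right side is literally an `avg`.
    μ s 0 ℚ.+ ∑< m (μ s ∘ suc)                ≡⟨ cong₂ ℚ._+_ (law-turn-0 ½ s≢n) (∑<-cong m (law-turn ½ s≢n)) ⟩
    0ℚ ℚ.+ ∑< m (λ k → avg (λ t → μ t k) s)   ≡⟨ ℚ.+-identityˡ _ ⟩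
    ∑< m (λ k → avg (λ t → μ t k) s)          ≡⟨ ∑<-avg μ s m ⟩
    avg (λ t → S t m) s                       ∎
    where open ≡-Reasoning

  T-turn : ∀ {s} → s ≢ n → ∀ m → T s (suc m) ≡ avg (λ t → T t m) s
  T-turn {s} s≢n m = trans (cong (1ℚ -_) (S-turn s≢n m)) (split (S (suc s) m) (S (pred s) m))
    where
    split : ∀ a b → 1ℚ - (½ ℚ.* a ℚ.+ ½ ℚ.* b) ≡ ½ ℚ.* (1ℚ - a) ℚ.+ ½ ℚ.* (1ℚ - b)
    split = solve-∀ ℚ-ring

  -- At the target the summand with index 0 carries the whole mass. The index starts at 1 because
  -- `T n 0`, an empty sum subtracted from 1, is still 1.
  T-end : ∀ m → T n (suc m) ≡ 0ℚ
  T-end m = cong (1ℚ -_) (begin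
    ∑< (suc m) (μ n)              ≡⟨ ∑<-suc (μ n) m ⟩
    μ n 0 ℚ.+ ∑< m (μ n ∘ suc)    ≡⟨ cong₂ ℚ._+_ (law-end-0 ½ n) (trans (∑<-cong m (law-end ½ n)) (∑<-zero m)) ⟩
    1ℚ                            ∎)
    where open ≡-Reasoning

  -- The first turn shifts the duration by one. Splitting the weight `suc k` as `1 + k`, the part
  -- `k` yields the average of `W` and the part 1 the average of `S`.
  W-turn : ∀ {s} → s ≢ n → ∀ m → W s (suc m) ≡ avg (λ t → W t m) s ℚ.+ avg (λ t → S t m) s
  W-turn {s} s≢n m = begin
    W s (suc m)
      ≡⟨ ∑<-suc (λ k → fromℕ k ℚ.* μ s k) m ⟩
    0ℚ ℚ.* μ s 0 ℚ.+ ∑< m (λ k → fromℕ (suc k) ℚ.* μ s (suc k))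
      ≡⟨ cong₂ ℚ._+_ (ℚ.*-zeroˡ (μ s 0)) (∑<-cong m term) ⟩
    0ℚ ℚ.+ ∑< m (λ k → avg (λ t → fromℕ k ℚ.* μ t k) s ℚ.+ avg (λ t → μ t k) s)
      ≡⟨ ℚ.+-identityˡ _ ⟩
    ∑< m (λ k → avg (λ t → fromℕ k ℚ.* μ t k) s ℚ.+ avg (λ t → μ t k) s)
      ≡⟨ ∑<-+ (λ k → avg (λ t → fromℕ k ℚ.* μ t k) s) (λ k → avg (λ t → μ t k) s) m ⟩
    ∑< m (λ k → avg (λ t → fromℕ k ℚ.* μ t k) s) ℚ.+ ∑< m (λ k → avg (λ t → μ t k) s)
      ≡⟨ cong₂ ℚ._+_ (∑<-avg (λ t k → fromℕ k ℚ.* μ t k) s m) (∑<-avg μ s m) ⟩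
    avg (λ t → W t m) s ℚ.+ avg (λ t → S t m) s ∎
    where
    open ≡-Reasoning

    distrib : ∀ k a b → (1ℚ ℚ.+ k) ℚ.* (½ ℚ.* a ℚ.+ ½ ℚ.* b) ≡
      ½ ℚ.* (k ℚ.* a) ℚ.+ ½ ℚ.* (k ℚ.* b) ℚ.+ (½ ℚ.* a ℚ.+ ½ ℚ.* b)
    distrib = solve-∀ ℚ-ring

    term : ∀ k → fromℕ (suc k) ℚ.* μ s (suc k) ≡ avg (λ t → fromℕ k ℚ.* μ t k) s ℚ.+ avg (λ t → μ t k) s
    term k = trans (cong₂ ℚ._*_ (fromℕ-suc k) (law-turn ½ s≢n k)) (distrib (fromℕ k) (μ (suc s) k) (μ (pred s) k))

  -- The 1 from `h-avg` minus the average of `S` from `W-turn` is the average of `T`.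
  D-turn : ∀ {s} → s ≢ n → ∀ m → D s (suc m) ≡ avg (λ t → D t m) s ℚ.+ avg (λ t → T t m) s
  D-turn {s} s≢n m = trans (cong₂ _-_ (h-avg s) (W-turn s≢n m))
    (split (h (suc s)) (h (pred s)) (W (suc s) m) (W (pred s) m) (S (suc s) m) (S (pred s) m))
    where
    split : ∀ a b c d e f →
      1ℚ ℚ.+ (½ ℚ.* a ℚ.+ ½ ℚ.* b) - (½ ℚ.* c ℚ.+ ½ ℚ.* d ℚ.+ (½ ℚ.* e ℚ.+ ½ ℚ.* f)) ≡
      ½ ℚ.* (a - c) ℚ.+ ½ ℚ.* (b - d) ℚ.+ (½ ℚ.* (1ℚ - e) ℚ.+ ½ ℚ.* (1ℚ - f))
    split = solve-∀ ℚ-ring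

  D-end : ∀ m → D n (suc m) ≡ 0ℚ
  D-end m = cong₂ _-_ (ℚ.+-inverseʳ (fromℕ (n * (n + 1)))) (begin
    W n (suc m)
      ≡⟨ ∑<-suc (λ k → fromℕ k ℚ.* μ n k) m ⟩
    0ℚ ℚ.* μ n 0 ℚ.+ ∑< m (λ k → fromℕ (suc k) ℚ.* μ n (suc k))
      ≡⟨ cong₂ ℚ._+_ (ℚ.*-zeroˡ (μ n 0)) (∑<-cong m λ k →
           trans (cong (fromℕ (suc k) ℚ.*_) (law-end ½ n k)) (ℚ.*-zeroʳ (fromℕ (suc k)))) ⟩
    0ℚ ℚ.+ ∑< m (λ _ → 0ℚ)
      ≡⟨ cong (0ℚ ℚ.+_) (∑<-zero m) ⟩
    0ℚ ∎)
    where open ≡-Reasoning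

  -- Induction along the play, and nonnegativity.

  -- Induction on `m` for all `s ≤ n` at once. The target is a separate case, since the recursions
  -- need `s ≢ n`; elsewhere `s < n`, so both neighbours stay in range.
  play-induction : (P : ℕ → ℕ → Set) →
    (∀ {s} → s ≤ n → P s 0) →
    (∀ {m} → P n (suc m)) →
    (∀ {s m} → s ≢ n → suc s ≤ n → pred s ≤ n → P (suc s) m → P (pred s) m → P s (suc m)) →
    ∀ m {s} → s ≤ n → P s m
  play-induction P start stop move zero    s≤n = start s≤n
  play-induction P start stop move (suc m) {s} s≤n with s ℕ.≟ n
  ... | yes refl = stop
  ... | no  s≢n  = move s≢n s<n s-1≤n
    (play-induction P start stop move m s<n)
    (play-induction P start stop move m s-1≤n)
    where
    s<n   = ℕ.≤∧≢⇒< s≤n s≢n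
    s-1≤n = ℕ.≤-trans ℕ.pred[n]≤n s≤n

  T-nonNeg : ∀ m {s} → s ≤ n → 0ℚ ℚ.≤ T s m
  T-nonNeg = play-induction (λ s m → 0ℚ ℚ.≤ T s m)
    (λ _ → ℚ.nonNegative⁻¹ 1ℚ)
    (λ {m} → ℚ.≤-reflexive (sym (T-end m)))
    λ {s} {m} s≢n _ _ T₊ T₋ → subst (0ℚ ℚ.≤_) (sym (T-turn s≢n m)) (avg-nonNeg {λ t → T t m} {s} T₊ T₋)

  h-nonNeg : ∀ {s} → s ≤ n → 0ℚ ℚ.≤ h s
  h-nonNeg s≤n = p≤q⇒0≤q-p (fromℕ-mono-≤ (ℕ.*-mono-≤ s≤n (ℕ.+-monoˡ-≤ 1 s≤n)))

  D-start : ∀ s → D s 0 ≡ h s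
  D-start s = ℚ.+-identityʳ (h s)

  -- The recursion preserves the sign, because its source term is an average of `T`. Hence no
  -- truncated expectation exceeds `h s`.
  D-nonNeg : ∀ m {s} → s ≤ n → 0ℚ ℚ.≤ D s m
  D-nonNeg = play-induction (λ s m → 0ℚ ℚ.≤ D s m)
    (λ {s} s≤n → ℚ.≤-trans (h-nonNeg s≤n) (ℚ.≤-reflexive (sym (D-start s))))
    (λ {m} → ℚ.≤-reflexive (sym (D-end m)))
    λ {s} {m} s≢n s<n s-1≤n D₊ D₋ → subst (0ℚ ℚ.≤_) (sym (D-turn s≢n m))
      (0≤+ (avg-nonNeg {λ t → D t m} {s} D₊ D₋)
           (avg-nonNeg {λ t → T t m} {s} (T-nonNeg m s<n) (T-nonNeg m s-1≤n)))

  -- Geometric decay of the tail and of the missing expectation.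

  -- Twice the bound `n(n+1) + 1` for `g`. The factor 2 leaves room for the inflow from `T` in
  -- `D-decay`.
  k : ℕ
  k = 2 * suc (n * (n + 1))

  K : ℚ
  K = fromℕ k

  instance
    K-positive : ℚ.Positive K
    K-positive = ℚ.normalize-pos k 1

    K-nonZero : ℚ.NonZero K
    K-nonZero = ℚ.pos⇒nonZero K

  τ : ℚ
  τ = ℚ.1/ K

  Kτ≡1 : K ℚ.* τ ≡ 1ℚ
  Kτ≡1 = ℚ.*-inverseʳ K

  0≤K : 0ℚ ℚ.≤ K
  0≤K = 0≤fromℕ k

  1≤K : 1ℚ ℚ.≤ K
  1≤K = fromℕ-mono-≤ {1} {k} (ℕ.s≤s ℕ.z≤n)

  0≤τ : 0ℚ ℚ.≤ τ
  0≤τ = ℚ.<⇒≤ (ℚ.positive⁻¹ τ {{ℚ.1/pos⇒pos K}})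

  τ≤1 : τ ℚ.≤ 1ℚ
  τ≤1 = subst₂ ℚ._≤_ (ℚ.*-identityˡ τ) Kτ≡1 (*-monoʳ-≤ 0≤τ 1≤K)

  g-nonNeg : ∀ {s} → s ≤ n → 0ℚ ℚ.≤ g s
  g-nonNeg s≤n = 0≤+ (h-nonNeg s≤n) (ℚ.nonNegative⁻¹ 1ℚ)

  2g≤K : ∀ s → g s ℚ.+ g s ℚ.≤ K
  2g≤K s = ≤-by-difference (0≤+ (0≤fromℕ (s * (s + 1))) (0≤fromℕ (s * (s + 1))))
    (trans (trans (fromℕ-* 2 (suc (n * (n + 1)))) (cong (fromℕ 2 ℚ.*_) (fromℕ-suc (n * (n + 1)))))
      (double (fromℕ (n * (n + 1))) (fromℕ (s * (s + 1)))))
    where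
    double : ∀ e a → (1ℚ ℚ.+ 1ℚ) ℚ.* (1ℚ ℚ.+ e) ≡ e - a ℚ.+ 1ℚ ℚ.+ (e - a ℚ.+ 1ℚ) ℚ.+ (a ℚ.+ a)
    double = solve-∀ ℚ-ring

  g≤K : ∀ {s} → s ≤ n → g s ℚ.≤ K
  g≤K {s} s≤n = ℚ.≤-trans (≤-by-difference (g-nonNeg s≤n) refl) (2g≤K s)

  r : ℕ → ℚ
  r zero    = 1ℚ
  r (suc m) = (1ℚ - τ) ℚ.* r m

  r-nonNeg : ∀ m → 0ℚ ℚ.≤ r m
  r-nonNeg zero    = ℚ.nonNegative⁻¹ 1ℚ
  r-nonNeg (suc m) = 0≤* (p≤q⇒0≤q-p τ≤1) (r-nonNeg m)

  -- This is `(1 - τ)^m (1 + m τ) ≤ 1` scaled by `K`. In the inductive step `(1 - τ)(K + m + 1)`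
  -- equals `K + m - τ(m + 1)`, because `K τ = 1`.
  r-bernoulli : ∀ m → r m ℚ.* (K ℚ.+ fromℕ m) ℚ.≤ K
  r-bernoulli zero    = ℚ.≤-reflexive (trans (ℚ.*-identityˡ _) (ℚ.+-identityʳ K))
  r-bernoulli (suc m) = ℚ.≤-trans
    (≤-by-difference (0≤* (r-nonNeg m) (0≤* 0≤τ (0≤fromℕ (suc m)))) (begin
      r m ℚ.* (K ℚ.+ fromℕ m)
        ≡⟨ regroup (r m) K (fromℕ m) τ ⟩
      (1ℚ - τ) ℚ.* r m ℚ.* (K ℚ.+ (1ℚ ℚ.+ fromℕ m)) ℚ.+ r m ℚ.* (K ℚ.* τ - 1ℚ ℚ.+ τ ℚ.* (1ℚ ℚ.+ fromℕ m))
        -- `regroup` holds for independent `K` and `τ` and isolates `K τ - 1`; only here is this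
        -- term replaced by 0.
        ≡⟨ cong₂ (λ x y → r (suc m) ℚ.* (K ℚ.+ x) ℚ.+ r m ℚ.* (y - 1ℚ ℚ.+ τ ℚ.* x)) (sym (fromℕ-suc m)) Kτ≡1 ⟩
      r (suc m) ℚ.* (K ℚ.+ fromℕ (suc m)) ℚ.+ r m ℚ.* (0ℚ ℚ.+ τ ℚ.* fromℕ (suc m))
        ≡⟨ cong (λ x → r (suc m) ℚ.* (K ℚ.+ fromℕ (suc m)) ℚ.+ r m ℚ.* x) (ℚ.+-identityˡ _) ⟩
      r (suc m) ℚ.* (K ℚ.+ fromℕ (suc m)) ℚ.+ r m ℚ.* (τ ℚ.* fromℕ (suc m)) ∎))
    (r-bernoulli m)
    where
    open ≡-Reasoning
    regroup : ∀ r K m t → r ℚ.* (K ℚ.+ m) ≡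
      (1ℚ - t) ℚ.* r ℚ.* (K ℚ.+ (1ℚ ℚ.+ m)) ℚ.+ r ℚ.* (K ℚ.* t - 1ℚ ℚ.+ t ℚ.* (1ℚ ℚ.+ m))
    regroup = solve-∀ ℚ-ring

  -- By linearity it is enough that the average of `g` is `1 + avg h s`, which is `h s` by `h-avg`.
  avg-gr : ∀ c s q → avg (λ t → c ℚ.* g t ℚ.* q) s ≡ c ℚ.* h s ℚ.* q
  avg-gr c s q = trans (collect c q (h (suc s)) (h (pred s))) (cong (λ x → c ℚ.* x ℚ.* q) (sym (h-avg s)))
    where
    collect : ∀ c q a b → ½ ℚ.* (c ℚ.* (a ℚ.+ 1ℚ) ℚ.* q) ℚ.+ ½ ℚ.* (c ℚ.* (b ℚ.+ 1ℚ) ℚ.* q) ≡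
      c ℚ.* (1ℚ ℚ.+ (½ ℚ.* a ℚ.+ ½ ℚ.* b)) ℚ.* q
    collect = solve-∀ ℚ-ring

  -- Equivalently `h ≤ g (1 - τ)`: the 1 that `g` loses under averaging pays for the factor `1 - τ`.
  gτ≤1 : ∀ {s} → s ≤ n → g s ℚ.* τ ℚ.≤ 1ℚ
  gτ≤1 s≤n = ℚ.≤-trans (*-monoʳ-≤ 0≤τ (g≤K s≤n)) (ℚ.≤-reflexive Kτ≡1)

  -- The factor 1 gives this bound the shape K g r of the bound on D, so that
  -- avg-gr and r-rate serve both.
  T-decay : ∀ m {s} → s ≤ n → T s m ℚ.≤ 1ℚ ℚ.* g s ℚ.* r m
  T-decay = play-induction (λ s m → T s m ℚ.≤ 1ℚ ℚ.* g s ℚ.* r m)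
    (λ {s} s≤n → ≤-by-difference (h-nonNeg s≤n) (initial (h s)))
    (λ {m} → ℚ.≤-trans (ℚ.≤-reflexive (T-end m)) (0≤* (0≤* (ℚ.nonNegative⁻¹ 1ℚ) (g-nonNeg ℕ.≤-refl)) (r-nonNeg (suc m))))
    λ {s} {m} s≢n s<n _ T₊ T₋ → begin
      T s (suc m)                             ≡⟨ T-turn s≢n m ⟩
      avg (λ t → T t m) s                     ≤⟨ avg-mono-≤ {λ t → T t m} {λ t → 1ℚ ℚ.* g t ℚ.* r m} {s} T₊ T₋ ⟩
      avg (λ t → 1ℚ ℚ.* g t ℚ.* r m) s        ≡⟨ avg-gr 1ℚ s (r m) ⟩
      1ℚ ℚ.* h s ℚ.* r m                      ≤⟨ ≤-by-difference
                                                   (0≤* (p≤q⇒0≤q-p (gτ≤1 (ℕ.<⇒≤ s<n))) (r-nonNeg m))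
                                                   (slack (h s) τ (r m)) ⟩
      1ℚ ℚ.* g s ℚ.* r (suc m)                ∎
    where
    open ℚ.≤-Reasoning
    initial : ∀ h → 1ℚ ℚ.* (h ℚ.+ 1ℚ) ℚ.* 1ℚ ≡ 1ℚ ℚ.+ h
    initial = solve-∀ ℚ-ring
    slack : ∀ h t r → 1ℚ ℚ.* (h ℚ.+ 1ℚ) ℚ.* ((1ℚ - t) ℚ.* r) ≡ 1ℚ ℚ.* h ℚ.* r ℚ.+ (1ℚ - (h ℚ.+ 1ℚ) ℚ.* t) ℚ.* r
    slack = solve-∀ ℚ-ring

  -- In units of `r m`, averaging lowers the bound `K g` by `K`, the inflow from `T` adds at most
  -- `h = g - 1`, and the factor `1 - τ` costs `K g τ = g`. The balance `K - 2g + 1` is nonnegative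
  -- by the choice of `K`.
  D-decay : ∀ m {s} → s ≤ n → D s m ℚ.≤ K ℚ.* g s ℚ.* r m
  D-decay = play-induction (λ s m → D s m ℚ.≤ K ℚ.* g s ℚ.* r m)
    (λ {s} s≤n → ℚ.≤-trans (ℚ.≤-reflexive (D-start s))
      (≤-by-difference (0≤+ (0≤* (p≤q⇒0≤q-p 1≤K) (g-nonNeg s≤n)) (ℚ.nonNegative⁻¹ 1ℚ)) (initial K (h s))))
    (λ {m} → ℚ.≤-trans (ℚ.≤-reflexive (D-end m)) (0≤* (0≤* 0≤K (g-nonNeg ℕ.≤-refl)) (r-nonNeg (suc m))))
    λ {s} {m} s≢n s<n s-1≤n D₊ D₋ → begin
      D s (suc m)
        ≡⟨ D-turn s≢n m ⟩
      avg (λ t → D t m) s ℚ.+ avg (λ t → T t m) s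
        ≤⟨ ℚ.+-mono-≤ (avg-mono-≤ {λ t → D t m} {λ t → K ℚ.* g t ℚ.* r m} {s} D₊ D₋)
             (avg-mono-≤ {λ t → T t m} {λ t → 1ℚ ℚ.* g t ℚ.* r m} {s} (T-decay m s<n) (T-decay m s-1≤n)) ⟩
      avg (λ t → K ℚ.* g t ℚ.* r m) s ℚ.+ avg (λ t → 1ℚ ℚ.* g t ℚ.* r m) s
        ≡⟨ cong₂ ℚ._+_ (avg-gr K s (r m)) (avg-gr 1ℚ s (r m)) ⟩
      K ℚ.* h s ℚ.* r m ℚ.+ 1ℚ ℚ.* h s ℚ.* r m
        ≤⟨ ≤-by-difference
             (0≤* (0≤+ (p≤q⇒0≤q-p (2g≤K s)) (ℚ.nonNegative⁻¹ 1ℚ)) (r-nonNeg m)) (slack s m) ⟩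
      K ℚ.* g s ℚ.* r (suc m) ∎
    where
    initial : ∀ K h → K ℚ.* (h ℚ.+ 1ℚ) ℚ.* 1ℚ ≡ h ℚ.+ ((K - 1ℚ) ℚ.* (h ℚ.+ 1ℚ) ℚ.+ 1ℚ)
    initial = solve-∀ ℚ-ring

    slack : ∀ s m → K ℚ.* g s ℚ.* r (suc m) ≡
      K ℚ.* h s ℚ.* r m ℚ.+ 1ℚ ℚ.* h s ℚ.* r m ℚ.+ (K - (g s ℚ.+ g s) ℚ.+ 1ℚ) ℚ.* r m
    slack s m = trans (factor K (g s) τ (r m))
      (trans (cong (λ x → (K - x) ℚ.* g s ℚ.* r m) Kτ≡1) (expand K (h s) (r m)))
      where
      factor : ∀ K g t r → K ℚ.* g ℚ.* ((1ℚ - t) ℚ.* r) ≡ (K - K ℚ.* t) ℚ.* g ℚ.* r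
      factor = solve-∀ ℚ-ring

      expand : ∀ K h r → (K - 1ℚ) ℚ.* (h ℚ.+ 1ℚ) ℚ.* r ≡
        K ℚ.* h ℚ.* r ℚ.+ 1ℚ ℚ.* h ℚ.* r ℚ.+ (K - (h ℚ.+ 1ℚ ℚ.+ (h ℚ.+ 1ℚ)) ℚ.+ 1ℚ) ℚ.* r
      expand = solve-∀ ℚ-ring

    open ℚ.≤-Reasoning

  -- From geometric decay to convergence.

  -- One factor `k` bounds `g s`, the other bounds `r m * m` through `r-bernoulli`.
  r-rate : ∀ {U} c {s} m → s ≤ n →
    U ℚ.≤ fromℕ c ℚ.* g s ℚ.* r m → U ℚ.* fromℕ m ℚ.≤ fromℕ (c * k * k)
  r-rate {U} c {s} m s≤n U≤ = begin
    U ℚ.* fromℕ m                                   ≤⟨ *-monoʳ-≤ (0≤fromℕ m) U≤ ⟩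
    fromℕ c ℚ.* g s ℚ.* r m ℚ.* fromℕ m             ≡⟨ ℚ.*-assoc (fromℕ c ℚ.* g s) (r m) (fromℕ m) ⟩
    fromℕ c ℚ.* g s ℚ.* (r m ℚ.* fromℕ m)           ≤⟨ *-monoˡ-≤ (0≤* (0≤fromℕ c) (g-nonNeg s≤n)) (ℚ.≤-trans r*m≤r*[K+m] (r-bernoulli m)) ⟩
    fromℕ c ℚ.* g s ℚ.* K                           ≤⟨ *-monoʳ-≤ 0≤K (*-monoˡ-≤ (0≤fromℕ c) (g≤K s≤n)) ⟩
    fromℕ c ℚ.* K ℚ.* K                             ≡⟨ cong (ℚ._* K) (fromℕ-* c k) ⟨
    fromℕ (c * k) ℚ.* K                             ≡⟨ fromℕ-* (c * k) k ⟨
    fromℕ (c * k * k)                               ∎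
    where
    open ℚ.≤-Reasoning
    r*m≤r*[K+m] : r m ℚ.* fromℕ m ℚ.≤ r m ℚ.* (K ℚ.+ fromℕ m)
    r*m≤r*[K+m] = *-monoˡ-≤ (r-nonNeg m) (≤-by-difference 0≤K (ℚ.+-comm K (fromℕ m)))

proposition4 : (n s : ℕ) → s ≤ n →
    HasExpectation (law-X ½ n s) (fromℕ (n * (n + 1)) - fromℕ (s * (s + 1)))
proposition4 n s s≤n =
  -- The gaps `1ℚ - S s m` and `h s - W s m` are `T s m` and `D s m` by definition. Their bounds
  -- have leading factors `1ℚ` and `K`, that is `fromℕ 1` and `fromℕ k`.
  convergence-from-below (1 * k * k) (S s) 1ℚ
    (λ m → T-nonNeg m s≤n) (λ m → r-rate 1 m s≤n (T-decay m s≤n)) ,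
  convergence-from-below (k * k * k) (W s) (h s)
    (λ m → D-nonNeg m s≤n) (λ m → r-rate k m s≤n (D-decay m s≤n))
  where open Game n
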